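{- Let $m \ge 1$ be an integer. Let $(h(n))_{n\ge 1}$ be the non-decreasing sequence of non-negative integers with $h(1)=0$ in which, for each integer $k\ge 0$, the value $k$ appears exactly $mk+1$ times. Let $(a(n))_{n\ge1}$ be the sequence of positive integers defined by $a(1)=1$ and the nested recurrence $$a(n+1) = n - a^{(m)}(n) + a^{(m+1)}(n) \qquad (n\ge 1).$$ Then $a(n) = n - h(n)$ for all $n \ge 1$, and this is the unique sequence satisfying the recurrence with $a(1)=1$.
   Context: For a function $f$ on the positive integers, the iterates are defined by $f^{(0)}(n)=n$ and $f^{(j+1)}(n)=f(f^{(j)}(n))$; thus $a^{(m)}(n)$ denotes $a$ applied $m$ times to $n$. Equivalently, $h(n)=k$ if and only if $T^{\star}_k \le n < T^{\star}_{k+1}$, where $T^{\star}_k = 1 + m\binom{k}{2} + k$ for $k\ge 0$. -}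

module Defs where

open import Data.Nat using (ℕ; zero; suc; _+_; _*_; _∸_; _≤_; _<_; z≤n; s≤s; _<?_; pred)
open import Data.Nat.GeneralisedArithmetic using (fold)
open import Data.Nat.Properties
open import Data.Integer as ℤ using (+_)
open import Data.Fin using (Fin; toℕ; fromℕ<)
open import Data.Fin.Properties using (toℕ<n; toℕ-fromℕ<; toℕ-injective)
open import Data.Product using (∃; _×_; _,_; proj₁; proj₂)
open import Function.Bundles using (_↔_; mk↔ₛ′)
open import Relation.Binary.PropositionalEquality
  using (_≡_; refl; sym; trans; cong; cong₂; subst)
open import Relation.Nullary using (yes; no; contradiction)

-- Sequences indexed by the positive integers are functions on ℕ whose value
-- at 0 is irrelevant: every condition below is restricted to n ≥ 1, and the
-- sequences that are iterated map positive integers to positive integers.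

infixr 8 _^[_]_

_^[_]_ : (ℕ → ℕ) → ℕ → ℕ → ℕ
f ^[ j ] n = fold n f j

record IsH (m : ℕ) (h : ℕ → ℕ) : Set where
  field
    h-one    : h 1 ≡ 0
    h-mono   : ∀ i j → 1 ≤ i → i ≤ j → h i ≤ h j
    h-counts : ∀ k → Fin (m * k + 1) ↔ (∃ λ n → 1 ≤ n × h n ≡ k)

-- The recurrence is stated in ℤ, so that no truncated subtraction occurs.
record IsA (m : ℕ) (a : ℕ → ℕ) : Set where
  field
    a-pos : ∀ n → 1 ≤ n → 1 ≤ a n
    a-one : a 1 ≡ 1
    a-rec : ∀ n → 1 ≤ n →
            + a (suc n) ≡ (+ n ℤ.- + (a ^[ m ] n)) ℤ.+ + (a ^[ suc m ] n)

-- IsH is satisfiable for every m, so quantifying over all h with IsH m h is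
-- not vacuous.  The witness tracks the pair (current value k, number i of
-- earlier terms equal to k).
module HExists (m : ℕ) where

  step : ℕ × ℕ → ℕ × ℕ
  step (k , i) with i <? m * k
  ... | yes _ = k , suc i
  ... | no  _ = suc k , 0

  state : ℕ → ℕ × ℕ
  state n = fold (0 , 0) step n

  start : ℕ → ℕ
  start zero    = 0
  start (suc k) = suc (start k + m * k)

  Inv : ℕ → ℕ × ℕ → Set
  Inv n (k , i) = i ≤ m * k × start k + i ≡ n

  step-inv : ∀ n s → Inv n s → Inv (suc n) (step s)
  step-inv n (k , i) (i≤ , eq) with i <? m * k
  ... | yes i< = i< , trans (+-suc (start k) i) (cong suc eq)
  ... | no  i≮ = z≤n , trans (+-identityʳ _)
    (cong suc (trans (cong (λ x → start k + x) (≤-antisym (≮⇒≥ i≮) i≤)) eq))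

  state-inv : ∀ n → Inv n (state n)
  state-inv zero    = z≤n , refl
  state-inv (suc n) = step-inv n (state n) (state-inv n)

  step-within : ∀ k i → i < m * k → step (k , i) ≡ (k , suc i)
  step-within k i i< with i <? m * k
  ... | yes _ = refl
  ... | no i≮ = contradiction i< i≮

  step-last : ∀ k → step (k , m * k) ≡ (suc k , 0)
  step-last k with m * k <? m * k
  ... | yes lt = contradiction lt (<-irrefl refl)
  ... | no _   = refl

  state-start : ∀ k i → i ≤ m * k → state (start k + i) ≡ (k , i)
  state-start zero    zero    _  = refl
  state-start (suc k) zero    _  = trans (cong state (+-identityʳ (start (suc k))))
    (trans (cong step (state-start k (m * k) ≤-refl)) (step-last k))
  state-start k       (suc i) i< = trans (cong state (+-suc (start k) i))
    (trans (cong step (state-start k i (<⇒≤ i<))) (step-within k i i<))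

  h : ℕ → ℕ
  h n = proj₁ (state (pred n))

  step-mono : ∀ s → proj₁ s ≤ proj₁ (step s)
  step-mono (k , i) with i <? m * k
  ... | yes _ = ≤-refl
  ... | no  _ = n≤1+n k

  state-mono : ∀ i d → proj₁ (state i) ≤ proj₁ (state (d + i))
  state-mono i zero    = ≤-refl
  state-mono i (suc d) = ≤-trans (state-mono i d) (step-mono (state (d + i)))

  mono : ∀ i j → 1 ≤ i → i ≤ j → h i ≤ h j
  mono (suc i) (suc j) _ (s≤s i≤j) =
    subst (λ x → proj₁ (state i) ≤ proj₁ (state x)) (m∸n+n≡m i≤j) (state-mono i (j ∸ i))

  Positions : ℕ → Set
  Positions k = ∃ λ n → 1 ≤ n × h n ≡ k

  positions-≡ : ∀ {k} (p q : Positions k) → proj₁ p ≡ proj₁ q → p ≡ q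
  positions-≡ (n , p , e) (.n , q , e′) refl =
    cong (n ,_) (cong₂ _,_ (≤-irrelevant p q) (≡-irrelevant e e′))

  bound : ∀ k {i} → i ≤ m * k → i < m * k + 1
  bound k {i} i≤ = subst (i <_) (+-comm 1 (m * k)) (s≤s i≤)

  unbound : ∀ k {i} → i < m * k + 1 → i ≤ m * k
  unbound k {i} i< = ≤-pred (subst (i <_) (+-comm (m * k) 1) i<)

  to : ∀ k → Fin (m * k + 1) → Positions k
  to k j = suc (start k + toℕ j) , s≤s z≤n ,
    cong proj₁ (state-start k (toℕ j) (unbound k (toℕ<n j)))

  from : ∀ k → Positions k → Fin (m * k + 1)
  from k (suc n , _ , refl) = fromℕ< (bound k (proj₁ (state-inv n)))

  toℕ-from : ∀ k (p : Positions k) → toℕ (from k p) ≡ proj₂ (state (pred (proj₁ p)))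
  toℕ-from k (suc n , _ , refl) = toℕ-fromℕ< _

  to-from : ∀ k p → to k (from k p) ≡ p
  to-from k p@(suc n , _ , refl) = positions-≡ _ p
    (cong suc (trans (cong (λ x → start k + x) (toℕ-from k p)) (proj₂ (state-inv n))))

  from-to : ∀ k j → from k (to k j) ≡ j
  from-to k j = toℕ-injective (trans (toℕ-from k (to k j))
    (cong proj₂ (state-start k (toℕ j) (unbound k (toℕ<n j)))))

  isH : IsH m h
  isH = record
    { h-one    = refl
    ; h-mono   = mono
    ; h-counts = λ k → mk↔ₛ′ (to k) (from k) (to-from k) (from-to k)
    }

{-# OPTIONS --safe #-}

-- Let T k be the first index at which h takes the value k.  For a n = n − h n
-- the recurrence says h (n + 1) = 1 + h (aᵐ n).  If h (n + 1) = k + 1 then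
-- T k + m k ≤ n < T (k + 1) + m (k + 1).  On the block starting at T k the map a
-- subtracts k, and a is monotone, so m steps from n end at T k or above; from
-- T (k + 1) on it subtracts at least k + 1, so they end below T (k + 1).
-- Hence h (aᵐ n) = k.
-- Uniqueness holds because a maps {1, …, n} to itself: the right-hand side of
-- the recurrence at n only involves values that are already determined.
module Submission where

open import Defs
open import Data.Nat using (ℕ; _≤_)
open import Data.Integer using (+_; _-_)
open import Data.Product using (∃; _×_)
open import Relation.Binary.PropositionalEquality using (_≡_)

open import Data.Nat using (zero; suc; _+_; _*_; _∸_; _<_; z≤n; s≤s; s≤s⁻¹; _≤?_)
open import Data.Nat.Induction using (<-rec)
open import Data.Nat.Properties
import Data.Integer as ℤ
import Data.Integer.Properties as ℤ
open import Data.Integer.Tactic.RingSolver using (solve-∀)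
open import Data.Fin using (Fin; toℕ; fromℕ<)
open import Data.Fin.Properties using (toℕ<n; toℕ-fromℕ<; toℕ-injective; injective⇒≤)
open import Data.Product using (_,_; proj₁)
open import Function.Bundles using (Injection)
open import Function.Definitions using (Injective)
open import Function.Properties.Inverse using (↔⇒↣; ↔-sym)
open import Relation.Binary.PropositionalEquality
  using (refl; sym; trans; cong; cong₂; subst; module ≡-Reasoning)
open import Relation.Nullary using (yes; no; contradiction)

-- `fold` adds new applications on the outside; inductions that move the starting point peel off the
-- first one instead.
^[]-shift : ∀ (f : ℕ → ℕ) j n → f ^[ j ] f n ≡ f ^[ suc j ] n
^[]-shift f zero    n = refl
^[]-shift f (suc j) n = cong f (^[]-shift f j n)

iterate-≥1 : ∀ {f} → (∀ n → 1 ≤ n → 1 ≤ f n) → ∀ j {n} → 1 ≤ n → 1 ≤ f ^[ j ] n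
iterate-≥1 f-pos zero    1≤n = 1≤n
iterate-≥1 f-pos (suc j) 1≤n = f-pos _ (iterate-≥1 f-pos j 1≤n)

∸-as-ℤ : ∀ {c n} → c ≤ n → + (n ∸ c) ≡ + n - + c
∸-as-ℤ {c} {n} c≤n = trans (sym (ℤ.⊖-≥ c≤n)) (sym (ℤ.m-n≡m⊖n n c))

-- Uniqueness

module _ {m : ℕ} {a b : ℕ → ℕ} (A : IsA m a) (B : IsA m b)
         (a-≤ : ∀ n → a n ≤ n) where
  open IsA

  iterate-≤ : ∀ n j → a ^[ j ] n ≤ n
  iterate-≤ n zero    = ≤-refl
  iterate-≤ n (suc j) = ≤-trans (a-≤ _) (iterate-≤ n j)

  -- The orbit of n under `a` stays in {1, ..., n}, where both sequences agree.
  iterates-agree : ∀ {n} → 1 ≤ n → (∀ {i} → i ≤ n → 1 ≤ i → b i ≡ a i) →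
                   ∀ j → b ^[ j ] n ≡ a ^[ j ] n
  iterates-agree 1≤n eq zero    = refl
  iterates-agree 1≤n eq (suc j) =
    trans (cong b (iterates-agree 1≤n eq j)) (eq (iterate-≤ _ j) (iterate-≥1 (a-pos A) j 1≤n))

  IsA-unique : ∀ n → 1 ≤ n → b n ≡ a n
  IsA-unique = <-rec Agree step
    where
    Agree : ℕ → Set
    Agree n = 1 ≤ n → b n ≡ a n

    step : ∀ n → (∀ {i} → i < n → Agree i) → Agree n
    step 1 _ _ = trans (a-one B) (sym (a-one A))
    step (suc n@(suc _)) ih _ = ℤ.+-injective (trans (a-rec B n (s≤s z≤n))
      (trans (cong₂ (λ x y → (+ n - + x) ℤ.+ + y) (agree m) (agree (suc m)))
             (sym (a-rec A n (s≤s z≤n)))))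
      where
      agree : ∀ j → b ^[ j ] n ≡ a ^[ j ] n
      agree = iterates-agree (s≤s z≤n) (λ i≤n → ih (s≤s i≤n))

-- Block structure of h

module _ {m : ℕ} {h : ℕ → ℕ} (H : IsH m h) where
  open IsH H

  -- In closed form 1 + m·C(k, 2) + k: the block of the value k has length m k + 1.
  T : ℕ → ℕ
  T zero    = 1
  T (suc k) = suc (T k + m * k)

  k<T : ∀ k → k < T k
  k<T zero    = s≤s z≤n
  k<T (suc k) = s≤s (≤-trans (k<T k) (m≤m+n (T k) (m * k)))

  1≤T : ∀ k → 1 ≤ T k
  1≤T k = ≤-trans (s≤s z≤n) (k<T k)

  Preimage : ℕ → Set
  Preimage k = ∃ λ n → 1 ≤ n × h n ≡ k

  -- Both conditions on an index are propositions, so injectivity can be checked on indices alone.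
  preimage-≡ : ∀ {k} {p q : Preimage k} → proj₁ p ≡ proj₁ q → p ≡ q
  preimage-≡ {p = n , p , e} {q = .n , q , e′} refl =
    cong (n ,_) (cong₂ _,_ (≤-irrelevant p q) (≡-irrelevant e e′))

  preimage-≤ : ∀ {k r} (f : Fin r → Preimage k) → Injective _≡_ _≡_ f → r ≤ m * k + 1
  preimage-≤ {k} f f-inj =
    injective⇒≤ (λ eq → f-inj (Injection.injective (↔⇒↣ (↔-sym (h-counts k))) eq))

  preimage-≥ : ∀ {k r} (f : Preimage k → Fin r) → Injective _≡_ _≡_ f → m * k + 1 ≤ r
  preimage-≥ {k} f f-inj =
    injective⇒≤ (λ eq → Injection.injective (↔⇒↣ (h-counts k)) (f-inj eq))

  -- Pigeonhole: if h (T (k + 1)) were ≤ k, the value k would occur at least m k + 2 times;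
  -- if h n > k for some n < T (k + 1), it would occur at most m k times.
  mutual
    T≤⇒≤h : ∀ k {n} → T k ≤ n → k ≤ h n
    T≤⇒≤h zero    _  = z≤n
    T≤⇒≤h (suc k) {n} T≤n = ≰⇒> λ hn≤k →
      let
        in-block : ∀ (i : Fin (2 + m * k)) → T k + toℕ i ≤ n
        in-block i = ≤-trans (+-monoʳ-≤ (T k) (s≤s⁻¹ (toℕ<n i)))
                       (≤-trans (≤-reflexive (+-suc (T k) (m * k))) T≤n)
        pos : ∀ i → 1 ≤ T k + i
        pos i = ≤-trans (1≤T k) (m≤m+n (T k) i)
        f : Fin (2 + m * k) → Preimage k
        f i = T k + toℕ i , pos (toℕ i) ,
          ≤-antisym (≤-trans (h-mono _ n (pos (toℕ i)) (in-block i)) hn≤k)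
                    (T≤⇒≤h k (m≤m+n (T k) (toℕ i)))
        too-many = preimage-≤ f (λ eq → toℕ-injective (+-cancelˡ-≡ (T k) _ _ (cong proj₁ eq)))
      in 1+n≰n (≤-trans too-many (≤-reflexive (+-comm (m * k) 1)))

    <T⇒h< : ∀ k {n} → 1 ≤ n → n < T k → h n < k
    <T⇒h< zero    1≤n n<1 = contradiction (≤-trans n<1 1≤n) 1+n≰n
    <T⇒h< (suc k) {n} 1≤n n<T = s≤s (≮⇒≥ λ k<hn →
      let
        T≤ : (p : Preimage k) → T k ≤ proj₁ p
        T≤ (i , 1≤i , hi≡k) = ≮⇒≥ λ i<T → <⇒≢ (<T⇒h< k 1≤i i<T) hi≡k
        <n : (p : Preimage k) → proj₁ p < n
        <n (i , _ , hi≡k) = ≰⇒> λ n≤i →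
          <⇒≱ k<hn (≤-trans (h-mono n i 1≤n n≤i) (≤-reflexive hi≡k))
        offset< : (p : Preimage k) → proj₁ p ∸ T k < m * k
        offset< p = +-cancelˡ-< (T k) _ _ (≤-trans
          (≤-reflexive (cong suc (m+[n∸m]≡n (T≤ p))))
          (≤-trans (<n p) (s≤s⁻¹ n<T)))
        f : Preimage k → Fin (m * k)
        f p = fromℕ< (offset< p)
        toℕ-f : ∀ p → T k + toℕ (f p) ≡ proj₁ p
        toℕ-f p = trans (cong (λ x → T k + x) (toℕ-fromℕ< (offset< p))) (m+[n∸m]≡n (T≤ p))
        too-few = preimage-≥ f λ {p} {q} eq → preimage-≡
          (trans (sym (toℕ-f p)) (trans (cong (λ i → T k + toℕ i) eq) (toℕ-f q)))
      in 1+n≰n (≤-trans (≤-reflexive (+-comm 1 (m * k))) too-few))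

  T[h]≤ : ∀ {n} → 1 ≤ n → T (h n) ≤ n
  T[h]≤ 1≤n = ≮⇒≥ λ n<T → <-irrefl refl (<T⇒h< _ 1≤n n<T)

  <T[1+h] : ∀ n → n < T (suc (h n))
  <T[1+h] n = ≰⇒> λ T≤n → 1+n≰n (T≤⇒≤h _ T≤n)

  -- Follows from n < T n. It makes `a` positive and keeps n ∸ h n from being truncated.
  h< : ∀ {n} → 1 ≤ n → h n < n
  h< 1≤n = <T⇒h< _ 1≤n (k<T _)

  -- No block is empty, so h cannot skip a value: n + 1 ≤ T (1 + h n) < T (2 + h n).
  h-suc-≤ : ∀ {n} → h (suc n) ≤ suc (h n)
  h-suc-≤ {n} = s≤s⁻¹ (<T⇒h< (2 + h n) (s≤s z≤n)
    (s≤s (≤-trans (<T[1+h] n) (m≤m+n (T (suc (h n))) _))))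

  -- The candidate sequence and its iterates

  a : ℕ → ℕ
  a n = n ∸ h n

  a-≤ : ∀ n → a n ≤ n
  a-≤ n = m∸n≤m n (h n)

  a-mono : ∀ {i j} → i ≤ j → a i ≤ a j
  a-mono {i} {j} i≤j = subst (λ x → a i ≤ a x) (m∸n+n≡m i≤j) (go (j ∸ i))
    where
    go : ∀ d → a i ≤ a (d + i)
    go zero    = ≤-refl
    -- `a (d + i)` computes to the same value as `suc (d + i) ∸ suc (h (d + i))`.
    go (suc d) = ≤-trans (go d) (∸-monoʳ-≤ (suc (d + i)) h-suc-≤)

  -- By monotonicity the least admissible start p decides. As j ≤ m, p lies before T (k + 1), so one
  -- step subtracts at most k.
  iterate-≥T : ∀ k j {n} → j ≤ m → T k + j * k ≤ n → T k ≤ a ^[ j ] n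
  iterate-≥T k zero    _   le = ≤-trans (m≤m+n (T k) 0) le
  iterate-≥T k (suc j) {n} j<m le =
    subst (T k ≤_) (^[]-shift a j n) (iterate-≥T k j (<⇒≤ j<m) (begin
      T k + j * k              ≡⟨ m+n∸n≡m _ k ⟨
      T k + j * k + k ∸ k      ≡⟨ cong (_∸ k) (trans (+-assoc (T k) _ k)
                                    (cong (λ x → T k + x) (+-comm (j * k) k))) ⟩
      p ∸ k                    ≤⟨ ∸-monoʳ-≤ p hp≤k ⟩
      a p                      ≤⟨ a-mono le ⟩
      a n                      ∎))
    where
    open ≤-Reasoning
    p = T k + suc j * k
    hp≤k : h p ≤ k
    hp≤k = s≤s⁻¹ (<T⇒h< (suc k) (≤-trans (1≤T k) (m≤m+n (T k) _))
      (s≤s (+-monoʳ-≤ (T k) (*-monoˡ-≤ k j<m))))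

  -- A step from T k or above subtracts at least k; below T k the orbit never climbs back, so j is
  -- unrestricted.
  iterate-<T : ∀ k j {n} → n < T k + j * k → a ^[ j ] n < T k
  iterate-<T k zero    lt = ≤-trans lt (≤-reflexive (+-identityʳ (T k)))
  iterate-<T k (suc j) {n} lt = subst (_< T k) (^[]-shift a j n) (iterate-<T k j an<)
    where
    open ≤-Reasoning
    an< : a n < T k + j * k
    an< with T k ≤? n
    ... | no T≰n  = ≤-trans (s≤s (a-≤ n)) (≤-trans (≰⇒> T≰n) (m≤m+n (T k) _))
    ... | yes T≤n = +-cancelʳ-< k _ _ (begin-strict
      a n + k              ≤⟨ +-monoʳ-≤ (a n) (T≤⇒≤h k T≤n) ⟩
      a n + h n            ≡⟨ m∸n+n≡m (<⇒≤ (h< (≤-trans (1≤T k) T≤n))) ⟩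
      n                    <⟨ lt ⟩
      T k + (k + j * k)    ≡⟨ cong (λ x → T k + x) (+-comm k (j * k)) ⟩
      T k + (j * k + k)    ≡⟨ +-assoc (T k) _ k ⟨
      T k + j * k + k      ∎)

  -- The recurrence

  h-rec : ∀ {n} → 1 ≤ n → h (suc n) ≡ suc (h (a ^[ m ] n))
  h-rec {n} 1≤n with h (suc n) | T[h]≤ {suc n} (s≤s z≤n) | <T[1+h] (suc n)
  -- The value 0 is excluded because T 1 = 2 ≤ n + 1.
  ... | zero  | _  | lt =
    contradiction (≤-trans lt (≤-reflexive (cong (λ x → suc (suc x)) (*-zeroʳ m)))) (<⇒≱ (s≤s (s≤s 1≤n)))
  -- `T` of a successor unfolds to a successor, so `s≤s⁻¹` turns `le` and `lt` into the hypotheses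
  -- of the two iterate lemmas at j = m.
  ... | suc k | le | lt = cong suc (≤-antisym (T≤⇒≤h k T≤)
      (s≤s⁻¹ (<T⇒h< (suc k) (≤-trans (1≤T k) T≤) (iterate-<T (suc k) m (s≤s⁻¹ lt)))))
    where
    T≤ : T k ≤ a ^[ m ] n
    T≤ = iterate-≥T k m ≤-refl (s≤s⁻¹ le)

  a≥1 : ∀ n → 1 ≤ n → 1 ≤ a n
  a≥1 n 1≤n = m<n⇒0<n∸m (h< 1≤n)

  a-isA : IsA m a
  a-isA = record
    { a-pos = a≥1
    ; a-one = cong (1 ∸_) h-one
    ; a-rec = rec
    }
    where
    open ≡-Reasoning
    -- With x = aᵐ n and c = h x, the last bracket is a x, the (m + 1)-st iterate.
    cancel : ∀ n x c → n - c ≡ (n - x) ℤ.+ (x - c)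
    cancel = solve-∀

    rec : ∀ n → 1 ≤ n → + a (suc n) ≡ (+ n - + (a ^[ m ] n)) ℤ.+ + (a ^[ suc m ] n)
    rec n 1≤n = begin
      + (suc n ∸ h (suc n))         ≡⟨ cong (λ y → + (suc n ∸ y)) (h-rec 1≤n) ⟩
      + (n ∸ h x)                   ≡⟨ ∸-as-ℤ hx≤n ⟩
      + n - + h x                   ≡⟨ cancel (+ n) (+ x) (+ h x) ⟩
      (+ n - + x) ℤ.+ (+ x - + h x) ≡⟨ cong (λ y → (+ n - + x) ℤ.+ y)
                                       (∸-as-ℤ (<⇒≤ (h< (iterate-≥1 a≥1 m 1≤n)))) ⟨
      (+ n - + x) ℤ.+ + a x         ∎
      where
      x = a ^[ m ] n
      -- No truncation in n ∸ h x, since 1 + h x = h (n + 1) ≤ n + 1.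
      hx≤n : h x ≤ n
      hx≤n = s≤s⁻¹ (≤-trans (≤-reflexive (sym (h-rec 1≤n))) (<⇒≤ (h< (s≤s z≤n))))

mainTheorem1 : (m : ℕ) → 1 ≤ m → (h : ℕ → ℕ) → IsH m h →
    ∃ λ (a : ℕ → ℕ) → IsA m a
    × (∀ n → 1 ≤ n → + a n ≡ + n - + h n)
    × (∀ (b : ℕ → ℕ) → IsA m b → ∀ n → 1 ≤ n → b n ≡ a n)
mainTheorem1 m _ h H = a H , a-isA H
  , (λ n 1≤n → ∸-as-ℤ (<⇒≤ (h< H 1≤n)))
  , (λ b B → IsA-unique (a-isA H) B (a-≤ H))
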